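{- Let $r,p,q,n$ be positive integers with $p\mid r$, $q\mid r$, $pq\mid rn$, and let $g\in G(r,p,q,n)$. Then $g\bar g=1$ in $G(r,p,q,n)$ if and only if either $g$ is symmetric, or $q$ is even and $g$ is antisymmetric.
   Context: $G(r,n)$ is the group of $n\times n$ monomial matrices whose nonzero entries are $r$-th roots of unity; write $\zeta_r^{z_i(g)}$ ($\zeta_r=e^{2\pi i/r}$, $z_i(g)\in\mathbb Z/r\mathbb Z$) for the nonzero entry of row $i$ of $g$. $G(r,p,n)=\{g\in G(r,n):\sum_iz_i(g)\equiv0\bmod p\}$, and $G(r,p,q,n)=G(r,p,n)/\langle\zeta_qI\rangle$. $\bar g$ is the complex conjugate, which induces an involution on $G(r,p,q,n)$. An element of $G(r,p,q,n)$ is symmetric (resp. antisymmetric) if some, equivalently every, lift to $G(r,n)$ is a symmetric matrix, $g^t=g$ (resp. an antisymmetric matrix, $g^t=-g$). -}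

module Defs where

open import Data.Nat as ℕ using (ℕ; zero; suc; NonZero)
open import Data.Nat.DivMod using (_/_)
open import Data.Integer as ℤ using (ℤ; +_; _+_; _-_; _*_; -_)
open import Data.Integer.Divisibility as ℤD using ()
open import Data.Fin using (Fin; _≟_)
import Data.Fin as Fin
open import Data.Fin.Permutation using (Permutation′; _⟨$⟩ʳ_; _∘ₚ_; id)
open import Data.Maybe using (Maybe; just; nothing)
open import Data.Product using (Σ; ∃; _×_; _,_)
open import Data.Empty using (⊥)
open import Data.Unit using (⊤)
open import Relation.Nullary using (yes; no)
open import Relation.Binary.PropositionalEquality using (_≡_)

_≡_[mod_] : ℤ → ℤ → ℕ → Set
a ≡ b [mod m ] = (+ m) ℤD.∣ (a - b)

sumFin : (n : ℕ) → (Fin n → ℤ) → ℤ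
sumFin zero    f = + 0
sumFin (suc n) f = f Fin.zero + sumFin n (λ i → f (Fin.suc i))

-- An element of G(r,n) is a monomial n×n matrix: row i has its unique
-- nonzero entry in column  perm ⟨$⟩ʳ i , equal to ζ_r^(exp i)
-- (exponents are integers, read modulo r).
record Mon (n : ℕ) : Set where
  constructor mon
  field
    perm : Permutation′ n
    exp  : Fin n → ℤ
open Mon public

InG : (r p n : ℕ) → Mon n → Set
InG r p n g = sumFin n (exp g) ≡ + 0 [mod p ]

-- Group operations of G(r,n) (matrix product, identity, complex conjugate).
-- (g h)_{i, σh(σg i)} = ζ^(z_i(g)) ζ^(z_{σg i}(h)).
_·_ : ∀ {n} → Mon n → Mon n → Mon n
g · h = mon (perm g ∘ₚ perm h) (λ i → exp g i + exp h (perm g ⟨$⟩ʳ i))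

one : ∀ {n} → Mon n
one = mon id (λ _ → + 0)

conj : ∀ {n} → Mon n → Mon n
conj g = mon (perm g) (λ i → - exp g i)

-- Equality in G(r,p,q,n) = G(r,p,n)/⟨ζ_q I⟩ where ζ_q = ζ_r^(r/q):
-- g ≈ h iff h = g · (ζ_q I)^k for some integer k.
EqQ : (r q n : ℕ) .{{_ : NonZero q}} → Mon n → Mon n → Set
EqQ r q n g h =
  (∀ i → perm g ⟨$⟩ʳ i ≡ perm h ⟨$⟩ʳ i) ×
  ∃ λ (k : ℤ) → ∀ i → exp h i ≡ exp g i + k * (+ (r / q)) [mod r ]

-- Matrix entries as complex numbers of the form 0 or ζ_{2r}^e
-- (ζ_r^a = ζ_{2r}^(2a), and -1 = ζ_{2r}^r), so negation is expressible.
Entry : Set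
Entry = Maybe ℤ

entry : ∀ {n} → Mon n → Fin n → Fin n → Entry
entry g i j with j ≟ (perm g ⟨$⟩ʳ i)
... | yes _ = just (+ 2 * exp g i)
... | no  _ = nothing

negE : ℕ → Entry → Entry
negE r (just e) = just (e + + r)
negE r nothing  = nothing

-- Equality of entries as complex numbers (ζ_{2r}^a = ζ_{2r}^b iff a ≡ b mod 2r).
EqE : ℕ → Entry → Entry → Set
EqE r (just a) (just b) = a ≡ b [mod (2 ℕ.* r) ]
EqE r nothing  nothing  = ⊤
EqE r _        _        = ⊥

Symmetric : (r : ℕ) → ∀ {n} → Mon n → Set
Symmetric r g = ∀ i j → EqE r (entry g j i) (entry g i j)

Antisymmetric : (r : ℕ) → ∀ {n} → Mon n → Set
Antisymmetric r g = ∀ i j → EqE r (entry g j i) (negE r (entry g i j))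

module Submission where

-- Write σ for the permutation of g and e i for its exponents, and put d = r/q,
-- so that ζ_q I has exponent d in every row.  The product g·ḡ has permutation
-- σ∘σ and exponents e i - e (σ i), hence g·ḡ = (ζ_q I)^(-k) exactly when σ is
-- an involution and g is "shifted by k·d": e (σ i) ≡ e i + k·d (mod r) for
-- every row i.  On the other side, reading off the transposed entries shows
-- that g is symmetric iff σ is an involution and g is shifted by 0, and (when
-- r = 2c) antisymmetric iff σ is an involution and g is shifted by c.
--
-- So everything reduces to a statement about the shift c = k·d.  Applying the
-- shift twice along the involution gives 2c ≡ 0 (mod r = q·d); cancelling d,
-- q ∣ 2k, and the parity of 2k/q decides the case: either c ≡ 0, or q = 2h and
-- c ≡ h·d = r/2.  The file develops congruence arithmetic, the shift-by-c
-- description of g·ḡ = 1, of symmetry and of antisymmetry, the half-turn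
-- classification, and finally combines them.

open import Defs
open import Data.Nat using (ℕ; NonZero; _*_)
open import Data.Nat.Divisibility using (_∣_)
open import Data.Product using (_×_)
open import Data.Sum using (_⊎_)
open import Function.Bundles using (_⇔_)

import Data.Nat as ℕ
import Data.Nat.Divisibility as ℕD
open import Data.Nat.DivMod using (_/_; m*[n/m]≡n)
import Data.Nat.Properties as ℕP
open import Data.Integer as ℤ using (ℤ; +_; -_; _+_; _-_; ∣_∣; _%ℕ_; _/ℕ_)
import Data.Integer.Properties as ℤP
import Data.Integer.Divisibility.Signed as ℤS
open import Data.Integer.DivMod using (a≡a%ℕn+[a/ℕn]*n; n%ℕd<d)
open import Data.Integer.Tactic.RingSolver using (solve-∀)
open import Data.Fin using (Fin; _≟_; fromℕ<)
open import Data.Fin.Permutation using (_⟨$⟩ʳ_)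
open import Data.Maybe using (just; nothing)
open import Data.Product using (∃; _,_; proj₁; proj₂)
open import Data.Sum using (inj₁; inj₂)
open import Data.Empty using (⊥-elim)
open import Data.Unit using (tt)
open import Relation.Nullary using (¬_; Dec; yes; no)
open import Relation.Binary.PropositionalEquality
open import Function.Bundles using (mk⇔; Equivalence)
open import Function.Properties.Equivalence using () renaming (trans to ⇔-trans)

-- Unlike the frozen
-- relation  _≡_[mod_]  (an unfolding definition), its endpoints can be
-- inferred by Agda, so the arithmetic below is done with it.
infix 4 _≋_⟨mod_⟩
record _≋_⟨mod_⟩ (a b : ℤ) (m : ℕ) : Set where
  constructor congruent
  field
    quotient   : ℤ
    difference : a - b ≡ quotient ℤ.* + m

module _ {m : ℕ} where

  ≋⇒mod : ∀ a b → a ≋ b ⟨mod m ⟩ → a ≡ b [mod m ]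
  ≋⇒mod _ _ (congruent t eq) = ℤS.∣⇒∣ᵤ (ℤS.divides t eq)

  mod⇒≋ : ∀ a b → a ≡ b [mod m ] → a ≋ b ⟨mod m ⟩
  mod⇒≋ a b c with ℤS.∣ᵤ⇒∣ {i = a - b} c
  ... | ℤS.divides t eq = congruent t eq

  ≋-by-difference : ∀ {a b a′ b′} → a - b ≡ a′ - b′ → a ≋ b ⟨mod m ⟩ → a′ ≋ b′ ⟨mod m ⟩
  ≋-by-difference same (congruent t eq) = congruent t (trans (sym same) eq)

  ≋-reflexive : ∀ {a b} → a ≡ b → a ≋ b ⟨mod m ⟩
  ≋-reflexive {a} refl = congruent (+ 0) (ℤP.+-inverseʳ a)

  ≋-sym : ∀ {a b} → a ≋ b ⟨mod m ⟩ → b ≋ a ⟨mod m ⟩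
  ≋-sym {a} {b} (congruent t eq) = congruent (- t) (begin
    b - a           ≡⟨ negate a b ⟩
    - (a - b)       ≡⟨ cong -_ eq ⟩
    - (t ℤ.* + m)   ≡⟨ ℤP.neg-distribˡ-* t (+ m) ⟩
    - t ℤ.* + m     ∎)
    where
    open ≡-Reasoning
    negate : ∀ a b → b - a ≡ - (a - b)
    negate = solve-∀

  ≋-trans : ∀ {a b c} → a ≋ b ⟨mod m ⟩ → b ≋ c ⟨mod m ⟩ → a ≋ c ⟨mod m ⟩
  ≋-trans {a} {b} {c} (congruent s ab) (congruent t bc) = congruent (s + t) (begin
    a - c                       ≡⟨ telescope a b c ⟩
    (a - b) + (b - c)           ≡⟨ cong₂ _+_ ab bc ⟩
    s ℤ.* + m + t ℤ.* + m       ≡⟨ ℤP.*-distribʳ-+ (+ m) s t ⟨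
    (s + t) ℤ.* + m             ∎)
    where
    open ≡-Reasoning
    telescope : ∀ a b c → a - c ≡ (a - b) + (b - c)
    telescope = solve-∀

  ≋-+ : ∀ {a b c d} → a ≋ b ⟨mod m ⟩ → c ≋ d ⟨mod m ⟩ → a + c ≋ b + d ⟨mod m ⟩
  ≋-+ {a} {b} {c} {d} (congruent s ab) (congruent t cd) = congruent (s + t) (begin
    (a + c) - (b + d)           ≡⟨ regroup a b c d ⟩
    (a - b) + (c - d)           ≡⟨ cong₂ _+_ ab cd ⟩
    s ℤ.* + m + t ℤ.* + m       ≡⟨ ℤP.*-distribʳ-+ (+ m) s t ⟨
    (s + t) ℤ.* + m             ∎)
    where
    open ≡-Reasoning
    regroup : ∀ a b c d → (a + c) - (b + d) ≡ (a - b) + (c - d)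
    regroup = solve-∀

  ≋-halve : ∀ {a b} → (+ 2 ℤ.* a ≋ + 2 ℤ.* b ⟨mod 2 * m ⟩) ⇔ (a ≋ b ⟨mod m ⟩)
  ≋-halve {a} {b} = mk⇔
    (λ (congruent t eq) → congruent t (ℤP.*-cancelˡ-≡ (+ 2) _ _
      (trans (sym (double-difference a b)) (trans eq (double-modulus t)))))
    (λ (congruent t eq) → congruent t
      (trans (double-difference a b) (trans (cong (+ 2 ℤ.*_) eq) (sym (double-modulus t)))))
    where
    double-difference : ∀ a b → + 2 ℤ.* a - + 2 ℤ.* b ≡ + 2 ℤ.* (a - b)
    double-difference = solve-∀
    double-modulus : ∀ t → t ℤ.* + (2 * m) ≡ + 2 ℤ.* (t ℤ.* + m)
    double-modulus t = begin
      t ℤ.* + (2 * m)          ≡⟨ cong (t ℤ.*_) (ℤP.pos-* 2 m) ⟩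
      t ℤ.* (+ 2 ℤ.* + m)      ≡⟨ swap t (+ m) ⟩
      + 2 ℤ.* (t ℤ.* + m)      ∎
      where
      open ≡-Reasoning
      swap : ∀ t m → t ℤ.* (+ 2 ℤ.* m) ≡ + 2 ℤ.* (t ℤ.* m)
      swap = solve-∀

σ : ∀ {n} → Mon n → Fin n → Fin n
σ g i = perm g ⟨$⟩ʳ i

Involutive : ∀ {n} → Mon n → Set
Involutive g = ∀ i → σ g (σ g i) ≡ i

ShiftedBy : (r : ℕ) → ℤ → ∀ {n} → Mon n → Set
ShiftedBy r c g = ∀ i → exp g (σ g i) ≋ exp g i + c ⟨mod r ⟩

shift-cong : ∀ {r c c′ n} {g : Mon n} → c ≋ c′ ⟨mod r ⟩ → ShiftedBy r c g → ShiftedBy r c′ g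
shift-cong {g = g} c≋c′ shifted i = ≋-trans (shifted i) (≋-+ (≋-reflexive {a = exp g i} refl) c≋c′)

-- Going once around a 2-cycle of an involution shifts by 2c, so 2c ≡ 0.
shift-twice : ∀ {r c n} {g : Mon n} → Involutive g → ShiftedBy r c g → Fin n
            → + 2 ℤ.* c ≋ + 0 ⟨mod r ⟩
shift-twice {c = c} {g = g} involutive shifted i =
  ≋-by-difference (round-trip (exp g i) (exp g (σ g i)) c) (≋-sym (≋-+ there back))
  where
  there : exp g (σ g i) ≋ exp g i + c ⟨mod _ ⟩
  there = shifted i
  back : exp g i ≋ exp g (σ g i) + c ⟨mod _ ⟩
  back = subst (λ j → exp g j ≋ exp g (σ g i) + c ⟨mod _ ⟩) (involutive i) (shifted (σ g i))
  round-trip : ∀ x y c → (x + c) + (y + c) - (y + x) ≡ + 2 ℤ.* c - + 0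
  round-trip = solve-∀

-- g·ḡ·(ζ_q I)^k = 1 in G(r,n) exactly when σ is an involution and g is
-- shifted by k·(r/q): g·ḡ has permutation σ∘σ and exponents e i - e (σ i).
conj-square⇔shifted : (r q n : ℕ) .{{_ : NonZero q}} (g : Mon n)
  → EqQ r q n (g · conj g) one ⇔ (Involutive g × ∃ λ k → ShiftedBy r (k ℤ.* + (r / q)) g)
conj-square⇔shifted r q n g = mk⇔
  (λ (involutive , k , trivial) → involutive , k , λ i →
     ≋-by-difference (rearrange (exp g i) (exp g (σ g i)) _)
       (mod⇒≋ (exp one i) (exp (g · conj g) i + k ℤ.* + (r / q)) (trivial i)))
  (λ (involutive , k , shifted) → involutive , k , λ i →
     ≋⇒mod (exp one i) (exp (g · conj g) i + k ℤ.* + (r / q))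
       (≋-by-difference (sym (rearrange (exp g i) (exp g (σ g i)) _)) (shifted i)))
  where
  rearrange : ∀ x y c → + 0 - ((x + - y) + c) ≡ y - (x + c)
  rearrange = solve-∀

entry-on : ∀ {n} (g : Mon n) i j → j ≡ σ g i → entry g i j ≡ just (+ 2 ℤ.* exp g i)
entry-on g i j on with j ≟ perm g ⟨$⟩ʳ i
... | yes _  = refl
... | no off = ⊥-elim (off on)

entry-off : ∀ {n} (g : Mon n) i j → ¬ j ≡ σ g i → entry g i j ≡ nothing
entry-off g i j off with j ≟ perm g ⟨$⟩ʳ i
... | yes on = ⊥-elim (off on)
... | no _   = refl

-- g^t is entrywise related to N(g); symmetry is N = id, antisymmetry N = -.
TransposeRelated : (r : ℕ) → (Entry → Entry) → ∀ {n} → Mon n → Set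
TransposeRelated r N g = ∀ i j → EqE r (entry g j i) (N (entry g i j))

transpose-related⇔ : (r : ℕ) (N : Entry → Entry)
  → EqE r nothing (N nothing) → (∀ a → ¬ EqE r nothing (N (just a)))
  → ∀ {n} (g : Mon n)
  → TransposeRelated r N g
    ⇔ (Involutive g × ∀ i → EqE r (just (+ 2 ℤ.* exp g (σ g i))) (N (just (+ 2 ℤ.* exp g i))))
transpose-related⇔ r N zero-zero nonzero-nonzero g = mk⇔
  (λ related → (λ i → proj₁ (cycle-of related i)) , (λ i → proj₂ (cycle-of related i)))
  (λ (involutive , cycle) i j → off-cycle involutive cycle i j (j ≟ σ g i))
  where
  Cycle : ∀ i → Set
  Cycle i = EqE r (just (+ 2 ℤ.* exp g (σ g i))) (N (just (+ 2 ℤ.* exp g i)))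

  -- Only the positions (σ i, i) and (i, σ i) carry information.
  on-cycle : ∀ i → EqE r (entry g (σ g i) i) (N (entry g i (σ g i))) → Dec (i ≡ σ g (σ g i))
           → σ g (σ g i) ≡ i × Cycle i
  on-cycle i related (yes back) = sym back
    , subst₂ (λ x y → EqE r x (N y)) (entry-on g (σ g i) i back) (entry-on g i (σ g i) refl) related
  on-cycle i related (no ¬back) = ⊥-elim (nonzero-nonzero _
    (subst₂ (λ x y → EqE r x (N y)) (entry-off g (σ g i) i ¬back) (entry-on g i (σ g i) refl) related))

  cycle-of : TransposeRelated r N g → ∀ i → σ g (σ g i) ≡ i × Cycle i
  cycle-of related i = on-cycle i (related i (σ g i)) (i ≟ σ g (σ g i))

  off-cycle : Involutive g → (∀ i → Cycle i) → ∀ i j → Dec (j ≡ σ g i)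
            → EqE r (entry g j i) (N (entry g i j))
  off-cycle involutive cycle i j (yes refl) =
    subst₂ (λ x y → EqE r x (N y))
      (sym (entry-on g (σ g i) i (sym (involutive i)))) (sym (entry-on g i (σ g i) refl)) (cycle i)
  off-cycle involutive cycle i j (no off) =
    subst₂ (λ x y → EqE r x (N y))
      (sym (entry-off g j i (λ i≡σj → off (sym (trans (cong (σ g) i≡σj) (involutive j))))))
      (sym (entry-off g i j off)) zero-zero

halved-shift : ∀ {r a b} c b′ → b′ ≡ + 2 ℤ.* (b + c)
  → EqE r (just (+ 2 ℤ.* a)) (just b′) ⇔ (a ≋ b + c ⟨mod r ⟩)
halved-shift {a = a} {b = b} c _ refl = mk⇔
  (λ related → Equivalence.to ≋-halve (mod⇒≋ (+ 2 ℤ.* a) (+ 2 ℤ.* (b + c)) related))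
  (λ shifted → ≋⇒mod (+ 2 ℤ.* a) (+ 2 ℤ.* (b + c)) (Equivalence.from ≋-halve shifted))

involutive-and⇔ : ∀ {n} {g : Mon n} {P Q : Fin n → Set}
  → (∀ i → P i ⇔ Q i) → (Involutive g × ∀ i → P i) ⇔ (Involutive g × ∀ i → Q i)
involutive-and⇔ P⇔Q = mk⇔
  (λ (involutive , p) → involutive , λ i → Equivalence.to (P⇔Q i) (p i))
  (λ (involutive , q) → involutive , λ i → Equivalence.from (P⇔Q i) (q i))

symmetric⇔shifted-by-zero : (r : ℕ) → ∀ {n} (g : Mon n)
  → Symmetric r g ⇔ (Involutive g × ShiftedBy r (+ 0) g)
symmetric⇔shifted-by-zero r g =
  ⇔-trans (transpose-related⇔ r (λ x → x) tt (λ _ ()) g) (involutive-and⇔ {g = g} λ i →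
    halved-shift {b = exp g i} (+ 0) _ (cong (+ 2 ℤ.*_) (sym (ℤP.+-identityʳ (exp g i)))))

-- If r = 2c, g is antisymmetric iff σ is an involution and g is shifted by c
-- (the factor -1 = ζ_{2r}^r of the transposed entry is the shift by c).
antisymmetric⇔shifted-by-half : (r : ℕ) (c : ℤ) → + r ≡ + 2 ℤ.* c → ∀ {n} (g : Mon n)
  → Antisymmetric r g ⇔ (Involutive g × ShiftedBy r c g)
antisymmetric⇔shifted-by-half r c r≡2c g =
  ⇔-trans (transpose-related⇔ r (negE r) tt (λ _ ()) g) (involutive-and⇔ {g = g} λ i →
    halved-shift {b = exp g i} c _ (trans (cong (λ x → + 2 ℤ.* exp g i + x) r≡2c)
                            (sym (ℤP.*-distribˡ-+ (+ 2) (exp g i) c))))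

parity : ∀ t → (∃ λ w → t ≡ w ℤ.* + 2) ⊎ (∃ λ w → t ≡ + 1 + w ℤ.* + 2)
parity t with t %ℕ 2 | a≡a%ℕn+[a/ℕn]*n t 2 | n%ℕd<d t 2
... | 0                 | t≡0+2w | _ = inj₁ (t /ℕ 2 , trans t≡0+2w (ℤP.+-identityˡ _))
... | 1                 | t≡1+2w | _ = inj₂ (t /ℕ 2 , t≡1+2w)
... | ℕ.suc (ℕ.suc _)   | _      | ℕ.s≤s (ℕ.s≤s ())

cancel-common-factor : (q d : ℕ) .{{_ : NonZero d}} (k : ℤ)
  → + 2 ℤ.* (k ℤ.* + d) ≋ + 0 ⟨mod q * d ⟩ → ∃ λ t → + 2 ℤ.* k ≡ t ℤ.* + q
cancel-common-factor q d k (congruent t 2kd≡tqd) = t , ℤP.*-cancelʳ-≡ _ _ (+ d) (begin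
  + 2 ℤ.* k ℤ.* + d            ≡⟨ reassociate k (+ d) ⟩
  + 2 ℤ.* (k ℤ.* + d) - + 0    ≡⟨ 2kd≡tqd ⟩
  t ℤ.* + (q * d)              ≡⟨ cong (t ℤ.*_) (ℤP.pos-* q d) ⟩
  t ℤ.* (+ q ℤ.* + d)          ≡⟨ ℤP.*-assoc t (+ q) (+ d) ⟨
  t ℤ.* + q ℤ.* + d            ∎)
  where
  open ≡-Reasoning
  reassociate : ∀ k d → + 2 ℤ.* k ℤ.* d ≡ + 2 ℤ.* (k ℤ.* d) - + 0
  reassociate = solve-∀

-- If q ∣ 2k then either q ∣ k, or q = 2h is even and k ≡ h (mod q),
-- according to the parity of 2k/q.
halves : (q : ℕ) (k t : ℤ) → + 2 ℤ.* k ≡ t ℤ.* + q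
  → (∃ λ w → k ≡ w ℤ.* + q) ⊎ (∃ λ h → q ≡ h * 2 × ∃ λ w → k ≡ + h + w ℤ.* + q)
halves q k t 2k≡tq with parity t
... | inj₁ (w , refl) =
  inj₁ (w , ℤP.*-cancelˡ-≡ (+ 2) k (w ℤ.* + q) (trans 2k≡tq (regroup w (+ q))))
  where
  regroup : ∀ w q → w ℤ.* + 2 ℤ.* q ≡ + 2 ℤ.* (w ℤ.* q)
  regroup = solve-∀
... | inj₂ (w , refl) = inj₂ (∣ X ∣ , q≡h*2 , w , k≡h+wq)
  where
  X : ℤ
  X = k - w ℤ.* + q
  -- q = (1 + 2w)·q - 2w·q = 2k - 2w·q
  q≡2X : + q ≡ X ℤ.* + 2
  q≡2X = begin
    + q                                        ≡⟨ peel w (+ q) ⟩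
    (+ 1 + w ℤ.* + 2) ℤ.* + q - w ℤ.* + 2 ℤ.* + q ≡⟨ cong (_- w ℤ.* + 2 ℤ.* + q) 2k≡tq ⟨
    + 2 ℤ.* k - w ℤ.* + 2 ℤ.* + q              ≡⟨ factor k w (+ q) ⟩
    X ℤ.* + 2                                  ∎
    where
    open ≡-Reasoning
    peel : ∀ w q → q ≡ (+ 1 + w ℤ.* + 2) ℤ.* q - w ℤ.* + 2 ℤ.* q
    peel = solve-∀
    factor : ∀ k w q → + 2 ℤ.* k - w ℤ.* + 2 ℤ.* q ≡ (k - w ℤ.* q) ℤ.* + 2
    factor = solve-∀
  q≡h*2 : q ≡ ∣ X ∣ * 2
  q≡h*2 = trans (cong ∣_∣ q≡2X) (ℤP.abs-* X (+ 2))
  h≡X : + ∣ X ∣ ≡ X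
  h≡X = ℤP.*-cancelʳ-≡ _ _ (+ 2)
          (trans (sym (ℤP.pos-* ∣ X ∣ 2)) (trans (cong +_ (sym q≡h*2)) q≡2X))
  k≡h+wq : k ≡ + ∣ X ∣ + w ℤ.* + q
  k≡h+wq = trans (restore k (w ℤ.* + q)) (cong (_+ w ℤ.* + q) (sym h≡X))
    where
    restore : ∀ k c → k ≡ (k - c) + c
    restore = solve-∀

half-turns : (q d : ℕ) .{{_ : NonZero d}} (k : ℤ)
  → + 2 ℤ.* (k ℤ.* + d) ≋ + 0 ⟨mod q * d ⟩
  → (k ℤ.* + d ≋ + 0 ⟨mod q * d ⟩)
    ⊎ (∃ λ h → q ≡ h * 2 × k ℤ.* + d ≋ + h ℤ.* + d ⟨mod q * d ⟩)
half-turns q d k twice with cancel-common-factor q d k twice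
... | t , 2k≡tq with halves q k t 2k≡tq
... | inj₁ (w , refl) =
  inj₁ (congruent w (trans (multiple w (+ q) (+ d)) (cong (w ℤ.*_) (sym (ℤP.pos-* q d)))))
  where
  multiple : ∀ w q d → w ℤ.* q ℤ.* d - + 0 ≡ w ℤ.* (q ℤ.* d)
  multiple = solve-∀
... | inj₂ (h , q≡h*2 , w , refl) =
  inj₂ (h , q≡h*2 ,
        congruent w (trans (multiple (+ h) w (+ q) (+ d)) (cong (w ℤ.*_) (sym (ℤP.pos-* q d)))))
  where
  multiple : ∀ h w q d → (h + w ℤ.* q) ℤ.* d - h ℤ.* d ≡ w ℤ.* (q ℤ.* d)
  multiple = solve-∀

shift-classification : (r q d : ℕ) .{{_ : NonZero d}} → q * d ≡ r
  → ∀ {n} .{{_ : NonZero n}} (g : Mon n)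
  → (Involutive g × ∃ λ k → ShiftedBy r (k ℤ.* + d) g) ⇔ (Symmetric r g ⊎ (2 ∣ q × Antisymmetric r g))
shift-classification _ q d refl {n} g = mk⇔ forward backward
  where
  r : ℕ
  r = q * d

  half : ∀ h → q ≡ h * 2 → + r ≡ + 2 ℤ.* (+ h ℤ.* + d)
  half h refl =
    trans (ℤP.pos-* (h * 2) d) (trans (cong (ℤ._* + d) (ℤP.pos-* h 2)) (swap (+ h) (+ d)))
    where
    swap : ∀ h d → h ℤ.* + 2 ℤ.* d ≡ + 2 ℤ.* (h ℤ.* d)
    swap = solve-∀

  forward : (Involutive g × ∃ λ k → ShiftedBy r (k ℤ.* + d) g) → Symmetric r g ⊎ (2 ∣ q × Antisymmetric r g)
  forward (involutive , k , shifted)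
    with half-turns q d k (shift-twice {g = g} involutive shifted (fromℕ< (ℕ.>-nonZero⁻¹ n)))
  ... | inj₁ c≡0 =
    inj₁ (Equivalence.from (symmetric⇔shifted-by-zero r g) (involutive , shift-cong {g = g} c≡0 shifted))
  ... | inj₂ (h , q≡h*2 , c≡hd) =
    inj₂ (ℕD.divides h q≡h*2 ,
          Equivalence.from (antisymmetric⇔shifted-by-half r (+ h ℤ.* + d) (half h q≡h*2) g)
                           (involutive , shift-cong {g = g} c≡hd shifted))

  backward : Symmetric r g ⊎ (2 ∣ q × Antisymmetric r g) → (Involutive g × ∃ λ k → ShiftedBy r (k ℤ.* + d) g)
  backward (inj₁ symmetric) =
    let involutive , shifted = Equivalence.to (symmetric⇔shifted-by-zero r g) symmetric
    in involutive , + 0 , shifted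
  backward (inj₂ (ℕD.divides h q≡h*2 , antisymmetric)) =
    let involutive , shifted = Equivalence.to
          (antisymmetric⇔shifted-by-half r (+ h ℤ.* + d) (half h q≡h*2) g) antisymmetric
    in involutive , + h , shifted

-- Lemma 4.2: g·ḡ = 1 in G(r,p,q,n) iff g is symmetric, or q is even and g is
-- antisymmetric.  Only q ∣ r (so that r = q·(r/q)) and n ≠ 0 are used.
lemma4p2 : (r p q n : ℕ) → .{{_ : NonZero r}} → .{{_ : NonZero p}} → .{{_ : NonZero q}} → .{{_ : NonZero n}}
    → p ∣ r → q ∣ r → (p * q) ∣ (r * n)
    → (g : Mon n) → InG r p n g
    → EqQ r q n (g · conj g) one ⇔ (Symmetric r g ⊎ (2 ∣ q × Antisymmetric r g))
lemma4p2 r p q n {{r≢0}} _ q∣r _ g _ =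
  ⇔-trans (conj-square⇔shifted r q n g)
          (shift-classification r q (r / q) {{d≢0}} q·d≡r g)
  where
  q·d≡r : q * (r / q) ≡ r
  q·d≡r = m*[n/m]≡n q∣r
  .d≢0 : NonZero (r / q)
  d≢0 = ℕP.m*n≢0⇒n≢0 q {{subst NonZero (sym q·d≡r) r≢0}}
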